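{- For all positive integers $n$ and $k$, the numbers of edges of the Munarini graph $M_{n,k}$ and of the generalized Pell graph $\Pi_{n,k}$ are $$|E(M_{n,k})|=|E(\Pi_{n,k})|=\frac{(k^2-k+2)\,n\,F_{n+1,k}+(k-2)(n+1)F_{n,k}}{k^2+4}.$$
   Context: For integers $k\geq 1$, $n\geq 0$, a $k$-generalized Pell string of length $n$ is a word of length $n$ over the alphabet $\{0,1,\ldots,k\}$ in which every maximal run of the character $k$ has even length (equivalently, a concatenation of letters from $\{0,1,\ldots,k-1,kk\}$). Let $\mathcal{F}_{n,k}$ be the set of these strings (for $n=0$ it contains only the empty string). The Munarini graph $M_{n,k}$ is the simple graph with vertex set $\mathcal{F}_{n,k}$ in which two vertices are adjacent if one of them can be obtained from the other either by replacing one occurrence of $0$ with some $i\in\{1,\ldots,k-1\}$, or by replacing one substring $00$ (two consecutive positions) with $kk$ (both replacements may be read in either direction, and both strings must be in $\mathcal{F}_{n,k}$). The generalized Pell graph $\Pi_{n,k}$ is the simple graph with vertex set $\mathcal{F}_{n,k}$ in which two vertices are adjacent if one of them can be obtained from the other either by replacing one occurrence of $i$ with $i+1$ for some $i\in\{0,1,\ldots,k-2\}$, or by replacing one substring $(k-1)(k-1)$ with $kk$ (both replacements may be read in either direction, and both strings must be in $\mathcal{F}_{n,k}$). The $k$-Fibonacci numbers are defined by $F_{0,k}=0$, $F_{1,k}=1$, $F_{n,k}=kF_{n-1,k}+F_{n-2,k}$ for $n\geq 2$. -}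

module Defs where

open import Data.Fin.Base using (Fin)
open import Data.List.Base using (List; _∷_; _++_; length; replicate; head; last)
open import Data.List.Properties using (++-cancelˡ; ∷-injectiveˡ)
open import Data.List.Relation.Unary.All using (All)
open import Data.Maybe.Base using (just)
open import Data.Nat.Base using (ℕ; zero; suc; _+_; _*_; _∸_; _≤_; _<_; NonZero; ≢-nonZero⁻¹)
open import Data.Nat.Divisibility using (_∣_)
open import Data.Nat.Properties using (<⇒≢; 1+n≢n)
open import Data.Product.Base using (_×_; _,_)
open import Data.Sum.Base as Sum using (_⊎_; inj₁; inj₂)
open import Function.Bundles using (Bijection)
open import Level using (0ℓ)
open import Relation.Binary.Bundles using (Setoid)
open import Relation.Binary.Core using (Rel)
open import Relation.Binary.Definitions using (Irreflexive; Symmetric; _Respects₂_)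
open import Relation.Binary.PropositionalEquality as ≡ using (_≡_; _≢_; refl; subst)

record SimpleGraph : Set₁ where
  field
    vertices : Setoid 0ℓ 0ℓ

  open Setoid vertices public renaming (Carrier to Vertex)

  field
    Adj        : Rel Vertex 0ℓ
    Adj-resp   : Adj Respects₂ _≈_
    Adj-sym    : Symmetric Adj
    Adj-irrefl : Irreflexive _≈_ Adj

  record Edge : Set where
    constructor edge
    field
      {source target} : Vertex
      adjacent        : Adj source target

  open Edge public

  -- Edges are unordered: an edge is identified with its reversal.
  _≈ᴱ_ : Rel Edge 0ℓ
  e ≈ᴱ f = (source e ≈ source f × target e ≈ target f)
         ⊎ (source e ≈ target f × target e ≈ source f)

  edges : Setoid 0ℓ 0ℓ
  edges = record
    { Carrier       = Edge
    ; _≈_           = _≈ᴱ_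
    ; isEquivalence = record
      { refl  = inj₁ (Setoid.refl vertices , Setoid.refl vertices)
      ; sym   = Sum.map (λ (p , q) → sym p , sym q) (λ (p , q) → sym q , sym p)
      ; trans = λ where
          (inj₁ (p , q)) (inj₁ (r , s)) → inj₁ (trans p r , trans q s)
          (inj₁ (p , q)) (inj₂ (r , s)) → inj₂ (trans p r , trans q s)
          (inj₂ (p , q)) (inj₁ (r , s)) → inj₂ (trans p s , trans q r)
          (inj₂ (p , q)) (inj₂ (r , s)) → inj₁ (trans p s , trans q r)
      }
    }

HasEdgeCount : SimpleGraph → ℕ → Set
HasEdgeCount G m = Bijection (≡.setoid (Fin m)) (SimpleGraph.edges G)

-- The two side conditions on u and v say that the displayed run of k's is
-- maximal; m = 0 is harmless.
EvenRuns : ℕ → List ℕ → Set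
EvenRuns k w = ∀ u m v → w ≡ u ++ replicate m k ++ v →
               last u ≢ just k → head v ≢ just k → 2 ∣ m

record PellString (n k : ℕ) : Set where
  field
    word      : List ℕ
    length≡n  : length word ≡ n
    letters≤k : All (_≤ k) word
    evenRuns  : EvenRuns k word

open PellString public

data MunariniStep (k : ℕ) : Rel (List ℕ) 0ℓ where
  single : ∀ u v {i} → 1 ≤ i → i < k → MunariniStep k (u ++ 0 ∷ v) (u ++ i ∷ v)
  double : ∀ u v → MunariniStep k (u ++ 0 ∷ 0 ∷ v) (u ++ k ∷ k ∷ v)

-- suc i < k is i ≤ k - 2 without truncated subtraction (k = 1 allows no i).
data PellStep (k : ℕ) : Rel (List ℕ) 0ℓ where
  single : ∀ u v {i} → suc i < k → PellStep k (u ++ i ∷ v) (u ++ suc i ∷ v)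
  double : ∀ u v → PellStep k (u ++ (k ∸ 1) ∷ (k ∸ 1) ∷ v) (u ++ k ∷ k ∷ v)

stepGraph : ∀ n k (Step : Rel (List ℕ) 0ℓ) → (∀ {x y} → Step x y → x ≢ y) → SimpleGraph
stepGraph n k Step step⇒≢ = record
  { vertices   = record
    { Carrier       = PellString n k
    ; _≈_           = λ s t → word s ≡ word t
    ; isEquivalence = record { refl = refl ; sym = ≡.sym ; trans = ≡.trans }
    }
  ; Adj        = λ s t → Step (word s) (word t) ⊎ Step (word t) (word s)
  ; Adj-resp   = (λ {s} eq → subst (λ w → Step (word s) w ⊎ Step w (word s)) eq)
               , (λ {s} eq → subst (λ w → Step w (word s) ⊎ Step (word s) w) eq)
  ; Adj-sym    = Sum.swap
  ; Adj-irrefl = λ where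
      eq (inj₁ st) → step⇒≢ st eq
      eq (inj₂ st) → step⇒≢ st (≡.sym eq)
  }

private
  differ : ∀ u {a b : ℕ} {v w} → a ≢ b → u ++ a ∷ v ≢ u ++ b ∷ w
  differ u a≢b eq = a≢b (∷-injectiveˡ (++-cancelˡ u _ _ eq))

  k∸1≢k : ∀ k .{{_ : NonZero k}} → k ∸ 1 ≢ k
  k∸1≢k (suc k) eq = 1+n≢n (≡.sym eq)

MunariniStep⇒≢ : ∀ {k} .{{_ : NonZero k}} {x y} → MunariniStep k x y → x ≢ y
MunariniStep⇒≢     (single u v 1≤i _) = differ u (<⇒≢ 1≤i)
MunariniStep⇒≢ {k} (double u v)       = differ u (λ eq → ≢-nonZero⁻¹ k (≡.sym eq))

PellStep⇒≢ : ∀ {k} .{{_ : NonZero k}} {x y} → PellStep k x y → x ≢ y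
PellStep⇒≢     (single u v _) = differ u (λ eq → 1+n≢n (≡.sym eq))
PellStep⇒≢ {k} (double u v)   = differ u (k∸1≢k k)

munariniGraph : ∀ n k .{{_ : NonZero k}} → SimpleGraph
munariniGraph n k = stepGraph n k (MunariniStep k) MunariniStep⇒≢

pellGraph : ∀ n k .{{_ : NonZero k}} → SimpleGraph
pellGraph n k = stepGraph n k (PellStep k) PellStep⇒≢

kFib : ℕ → ℕ → ℕ
kFib zero          k = 0
kFib (suc zero)    k = 1
kFib (suc (suc n)) k = k * kFib (suc n) k + kFib n k

{-# OPTIONS --safe #-}

-- A generalized Pell string is a tiling by the letters 0, …, k-1 and the pair kk.
-- In both graphs an edge is a string with one distinguished place, which either
-- carries one of k-1 single-letter changes or the one change of a pair into kk;
-- the rest of the string is an arbitrary tiling.  Splitting off the first tile,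
-- both edge numbers satisfy
--   e(n+2) = k e(n+1) + e(n) + (k-1) F(n+2) + F(n+1),
-- and the closed form is checked against this recurrence.
module Submission where

open import Data.Integer.Base using (+_; _+_; _-_; _*_; _^_)
open import Data.Nat.Base as ℕ using (ℕ; NonZero)
open import Data.Product.Base using (∃-syntax; _×_)
open import Data.Rational.Base using (_/_)
open import Relation.Binary.PropositionalEquality using (_≡_)
open import Defs

open import Data.Empty using (⊥)
open import Data.Fin.Base using (Fin; toℕ; fromℕ<)
open import Data.Fin.Properties using (toℕ<n; toℕ-injective; toℕ-fromℕ<; 0↔⊥; 1↔⊤; +↔⊎; *↔×)
open import Data.Integer.Base using (ℤ)
import Data.Integer.Properties as ℤ
open import Data.Integer.Solver using (module +-*-Solver)
open import Data.List.Base using (List; []; _∷_; _++_; length; head; last)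
open import Data.List.Properties using (∷-injectiveˡ; ∷-injectiveʳ)
open import Data.List.Relation.Unary.All using (All; []; _∷_)
open import Data.Maybe.Base using (just)
open import Data.Maybe.Properties using (just-injective)
open import Data.Nat.Base using (zero; suc; _≤_; _<_; z≤n; s≤s)
open import Data.Nat.Divisibility using (_∣0; ∣-refl; ∣m∣n⇒∣m+n; ∣m+n∣m⇒∣n; ∣⇒≤)
open import Data.Nat.ListAction using (sum)
open import Data.Nat.Properties using (_≟_; +-identityʳ; *-identityʳ; *-zeroʳ; ≤-refl; ≤-trans; <⇒≤; <⇒≢; <-irrefl; <-trans; ≤∧≢⇒<; suc-injective; +-mono-≤; +-mono-<-≤; +-monoʳ-<)
open import Data.Product.Base using (_,_)
open import Data.Product.Function.NonDependent.Propositional using (_×-↔_)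
open import Data.Rational.Properties using (fromℚᵘ-cong)
open import Data.Rational.Unnormalised.Base using (mkℚᵘ; *≡*)
open import Data.Sum.Base using (_⊎_; inj₁; inj₂)
open import Data.Sum.Function.Propositional using (_⊎-↔_)
open import Data.Unit.Base using (⊤; tt)
open import Function.Base using (_∘_; id; const)
open import Function.Bundles using (_↔_; module Inverse; module Injection)
open import Function.Properties.Inverse using (↔⇒↣)
open import Function.Construct.Composition using (_↔-∘_)
open import Function.Construct.Identity using (↔-id)
open import Level using (0ℓ)
open import Relation.Binary.Core using (Rel)
open import Relation.Binary.PropositionalEquality using (_≢_; refl; sym; trans; module ≡-Reasoning; cong; cong₂; subst; subst₂)
open import Relation.Nullary using (yes; no; contradiction)

open +-*-Solver using (Polynomial; solve; con; _:+_; _:*_; _:-_; _:=_)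

-- Even runs of `k` and tilings.

last-∷ : ∀ {A : Set} {a b : A} u → a ≢ b → last u ≢ just b → last (a ∷ u) ≢ just b
last-∷ []      a≢b _  = a≢b ∘ just-injective
last-∷ (_ ∷ _) _   ne = ne

last-tail : ∀ {A : Set} {a b : A} u → last (a ∷ u) ≢ just b → last u ≢ just b
last-tail []      _  ()
last-tail (_ ∷ _) ne = ne

module Pell (p : ℕ) where

  k : ℕ
  k = suc p

  data Tiled : List ℕ → Set where
    []     : Tiled []
    letter : ∀ {a w} → a < k → Tiled w → Tiled (a ∷ w)
    pair   : ∀ {w} → Tiled w → Tiled (k ∷ k ∷ w)

  Tiled⇒≤ : ∀ {w} → Tiled w → All (_≤ k) w
  Tiled⇒≤ []           = []
  Tiled⇒≤ (letter a t) = <⇒≤ a ∷ Tiled⇒≤ t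
  Tiled⇒≤ (pair t)     = ≤-refl ∷ ≤-refl ∷ Tiled⇒≤ t

  -- Tiles are stripped until the prefix `u` is used up. A maximal run neither starts nor ends
  -- inside a pair, so it then loses whole pairs, two characters at a time.
  Tiled⇒EvenRuns : ∀ {w} → Tiled w → EvenRuns k w
  Tiled⇒EvenRuns _            []          zero          v _  _ _ = 2 ∣0
  Tiled⇒EvenRuns (letter a _) []          (suc m)       v eq _ _ =
    contradiction (∷-injectiveˡ eq) (<⇒≢ a)
  Tiled⇒EvenRuns (letter _ t) (_ ∷ u)     m             v eq l h =
    Tiled⇒EvenRuns t u m v (∷-injectiveʳ eq) (last-tail u l) h
  -- The run would stop after the first half of the pair, so `v` would begin with `k`.
  Tiled⇒EvenRuns (pair t)     []          1             v eq l h =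
    contradiction (cong head (sym (∷-injectiveʳ eq))) h
  Tiled⇒EvenRuns (pair t)     []          (suc (suc m)) v eq l h =
    ∣m∣n⇒∣m+n ∣-refl (Tiled⇒EvenRuns t [] m v (∷-injectiveʳ (∷-injectiveʳ eq)) l h)
  -- The prefix is the first half of the pair, so it ends in `k`.
  Tiled⇒EvenRuns (pair t)     (_ ∷ [])    m             v eq l h =
    contradiction (cong just (sym (∷-injectiveˡ eq))) l
  Tiled⇒EvenRuns (pair t)     (_ ∷ _ ∷ u) m             v eq l h =
    Tiled⇒EvenRuns t u m v (∷-injectiveʳ (∷-injectiveʳ eq)) (last-tail u l) h

  -- Greedy parsing from the left: a leading `k` not followed by another `k` would be a maximal run
  -- of length 1, and 2 does not divide 1. After a letter below `k` is removed, runs of the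
  -- remainder are still maximal in the whole word.
  EvenRuns⇒Tiled : ∀ {w} → All (_≤ k) w → EvenRuns k w → Tiled w
  EvenRuns⇒Tiled [] _ = []
  EvenRuns⇒Tiled (_∷_ {x = a} a≤k ps) even with a ≟ k
  ... | no a≢k = letter (≤∧≢⇒< a≤k a≢k) (EvenRuns⇒Tiled ps λ u m v eq l h →
                   even (a ∷ u) m v (cong (a ∷_) eq) (last-∷ u a≢k l) h)
  EvenRuns⇒Tiled (_ ∷ []) even | yes refl
    = contradiction (∣⇒≤ (even [] 1 [] refl (λ ()) (λ ()))) λ { (s≤s ()) }
  EvenRuns⇒Tiled (_ ∷ _∷_ {x = b} _ ps) even | yes refl with b ≟ k
  ... | no b≢k = contradiction (∣⇒≤ (even [] 1 (b ∷ _) refl (λ ()) (b≢k ∘ just-injective)))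
                               λ { (s≤s ()) }
  ... | yes refl = pair (EvenRuns⇒Tiled ps λ where
          -- A run at the very start of the remainder merges with the removed pair: evenness is
          -- known for `2 + m` and passes to `m`.
          []      m v eq l h →
            ∣m+n∣m⇒∣n (even [] (2 ℕ.+ m) v (cong (λ w → k ∷ k ∷ w) eq) l h) ∣-refl
          (a ∷ u) m v eq l h →
            even (k ∷ k ∷ a ∷ u) m v (cong (λ w → k ∷ k ∷ w) eq) l h)

  Tiled⇒PellString : ∀ {n w} → length w ≡ n → Tiled w → PellString n k
  Tiled⇒PellString len t = record
    { length≡n = len ; letters≤k = Tiled⇒≤ t ; evenRuns = Tiled⇒EvenRuns t }

  -- Codes for strings and edges, and their number.

  -- Indexed as the k-Fibonacci numbers: Tiling (suc n) is the set of strings of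
  -- length n, and likewise EdgeCode (suc n) the set of edges between them.
  Tiling : ℕ → Set
  Tiling zero          = ⊥
  Tiling (suc zero)    = ⊤
  Tiling (suc (suc n)) = Fin k × Tiling (suc n) ⊎ Tiling n

  -- Either the edge changes the first letter or pair, or it keeps it.
  EdgeCode : ℕ → Set
  EdgeCode zero          = ⊥
  EdgeCode (suc zero)    = ⊥
  EdgeCode (suc (suc n)) = (Fin p × Tiling (suc n) ⊎ Tiling n)
                         ⊎ (Fin k × EdgeCode (suc n) ⊎ EdgeCode n)

  -- The arithmetic repeats the shape of `EdgeCode`, so that the counting bijection is assembled
  -- summand by summand.
  edgeCount : ℕ → ℕ
  edgeCount zero          = 0
  edgeCount (suc zero)    = 0
  edgeCount (suc (suc n)) = (p ℕ.* kFib (suc n) k ℕ.+ kFib n k)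
                            ℕ.+ (k ℕ.* edgeCount (suc n) ℕ.+ edgeCount n)

  private
    Fin-*+ : ∀ {a m n} {A B : Set} → Fin m ↔ A → Fin n ↔ B →
             Fin (a ℕ.* m ℕ.+ n) ↔ (Fin a × A ⊎ B)
    Fin-*+ {a} A↔ B↔ = (((↔-id (Fin a) ×-↔ A↔) ↔-∘ *↔×) ⊎-↔ B↔) ↔-∘ +↔⊎

  Tiling-count : ∀ n → Fin (kFib n k) ↔ Tiling n
  Tiling-count zero          = 0↔⊥
  Tiling-count (suc zero)    = 1↔⊤
  Tiling-count (suc (suc n)) = Fin-*+ (Tiling-count (suc n)) (Tiling-count n)

  EdgeCode-count : ∀ n → Fin (edgeCount n) ↔ EdgeCode n
  EdgeCode-count zero          = 0↔⊥
  EdgeCode-count (suc zero)    = 0↔⊥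
  EdgeCode-count (suc (suc n)) =
    (Fin-*+ (Tiling-count (suc n)) (Tiling-count n)
      ⊎-↔ Fin-*+ (EdgeCode-count (suc n)) (EdgeCode-count n)) ↔-∘ +↔⊎

  tiles : ∀ n → Tiling n → List ℕ
  tiles (suc zero)    _              = []
  tiles (suc (suc n)) (inj₁ (a , t)) = toℕ a ∷ tiles (suc n) t
  tiles (suc (suc n)) (inj₂ t)       = k ∷ k ∷ tiles n t

  tiles-length : ∀ n t → suc (length (tiles n t)) ≡ n
  tiles-length (suc zero)    _              = refl
  tiles-length (suc (suc n)) (inj₁ (_ , t)) = cong suc (tiles-length (suc n) t)
  tiles-length (suc (suc n)) (inj₂ t)       = cong (suc ∘ suc) (tiles-length n t)

  tiles-tiled : ∀ n t → Tiled (tiles n t)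
  tiles-tiled (suc zero)    _              = []
  tiles-tiled (suc (suc n)) (inj₁ (a , t)) = letter (toℕ<n a) (tiles-tiled (suc n) t)
  tiles-tiled (suc (suc n)) (inj₂ t)       = pair (tiles-tiled n t)

  -- Parsing is unambiguous: the first entry is below `k` for a letter and equal to `k` for a pair.
  tiles-injective : ∀ n s t → tiles n s ≡ tiles n t → s ≡ t
  tiles-injective (suc zero) _ _ _ = refl
  tiles-injective (suc (suc n)) (inj₁ (a , s)) (inj₁ (b , t)) eq =
    cong₂ (λ c r → inj₁ (c , r)) (toℕ-injective (∷-injectiveˡ eq))
                                 (tiles-injective (suc n) s t (∷-injectiveʳ eq))
  tiles-injective (suc (suc n)) (inj₁ (a , s)) (inj₂ t) eq =
    contradiction (∷-injectiveˡ eq) (<⇒≢ (toℕ<n a))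
  tiles-injective (suc (suc n)) (inj₂ s) (inj₁ (b , t)) eq =
    contradiction (sym (∷-injectiveˡ eq)) (<⇒≢ (toℕ<n b))
  tiles-injective (suc (suc n)) (inj₂ s) (inj₂ t) eq =
    cong inj₂ (tiles-injective n s t (∷-injectiveʳ (∷-injectiveʳ eq)))

  -- With `suc (length w)` as index, `tiles` reduces as soon as the first tile of `w` is known.
  tiles-surjective : ∀ {w} → Tiled w → ∃[ t ] tiles (suc (length w)) t ≡ w
  tiles-surjective []             = tt , refl
  tiles-surjective (letter a<k t) with s , eq ← tiles-surjective t =
    inj₁ (fromℕ< a<k , s) , cong₂ _∷_ (toℕ-fromℕ< a<k) eq
  tiles-surjective (pair t)       with s , eq ← tiles-surjective t =
    inj₂ s , cong (λ w → k ∷ k ∷ w) eq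

  -- Edges of both graphs through one step relation.

  -- Both graphs are of the following form: Munarini with base = const 0 and c = 0,
  -- Pell with base = id and c = k - 1.
  module Lowering (base : ℕ → ℕ) (base-≤ : ∀ j → base j ≤ j) (c : ℕ) (c<k : c < k) where

    data Step : Rel (List ℕ) 0ℓ where
      single : ∀ u v {j} → j < p → Step (u ++ base j ∷ v) (u ++ suc j ∷ v)
      double : ∀ u v → Step (u ++ c ∷ c ∷ v) (u ++ k ∷ k ∷ v)

    Step-∷ : ∀ a {x y} → Step x y → Step (a ∷ x) (a ∷ y)
    Step-∷ a (single u v j<p) = single (a ∷ u) v j<p
    Step-∷ a (double u v)     = double (a ∷ u) v

    base<k : ∀ {j} → j < p → base j < k
    base<k {j} j<p = s≤s (≤-trans (base-≤ j) (<⇒≤ j<p))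

    base≢suc : ∀ j → base j ≢ suc j
    base≢suc j = <⇒≢ (s≤s (base-≤ j))

    -- The two ends of the coded edge, oriented from the smaller to the larger. A changed letter is
    -- stored as `j` with new value `suc j`, so `Fin p` ranges over the new values 1 to `k - 1`.
    lower upper : ∀ n → EdgeCode n → List ℕ
    lower (suc (suc n)) (inj₁ (inj₁ (j , t))) = base (toℕ j) ∷ tiles (suc n) t
    lower (suc (suc n)) (inj₁ (inj₂ t))       = c ∷ c ∷ tiles n t
    lower (suc (suc n)) (inj₂ (inj₁ (a , e))) = toℕ a ∷ lower (suc n) e
    lower (suc (suc n)) (inj₂ (inj₂ e))       = k ∷ k ∷ lower n e
    upper (suc (suc n)) (inj₁ (inj₁ (j , t))) = suc (toℕ j) ∷ tiles (suc n) t
    upper (suc (suc n)) (inj₁ (inj₂ t))       = k ∷ k ∷ tiles n t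
    upper (suc (suc n)) (inj₂ (inj₁ (a , e))) = toℕ a ∷ upper (suc n) e
    upper (suc (suc n)) (inj₂ (inj₂ e))       = k ∷ k ∷ upper n e

    lower-length : ∀ n e → suc (length (lower n e)) ≡ n
    lower-length (suc (suc n)) (inj₁ (inj₁ (_ , t))) = cong suc (tiles-length (suc n) t)
    lower-length (suc (suc n)) (inj₁ (inj₂ t))       = cong (suc ∘ suc) (tiles-length n t)
    lower-length (suc (suc n)) (inj₂ (inj₁ (_ , e))) = cong suc (lower-length (suc n) e)
    lower-length (suc (suc n)) (inj₂ (inj₂ e))       = cong (suc ∘ suc) (lower-length n e)

    upper-length : ∀ n e → suc (length (upper n e)) ≡ n
    upper-length (suc (suc n)) (inj₁ (inj₁ (_ , t))) = cong suc (tiles-length (suc n) t)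
    upper-length (suc (suc n)) (inj₁ (inj₂ t))       = cong (suc ∘ suc) (tiles-length n t)
    upper-length (suc (suc n)) (inj₂ (inj₁ (_ , e))) = cong suc (upper-length (suc n) e)
    upper-length (suc (suc n)) (inj₂ (inj₂ e))       = cong (suc ∘ suc) (upper-length n e)

    lower-tiled : ∀ n e → Tiled (lower n e)
    lower-tiled (suc (suc n)) (inj₁ (inj₁ (j , t))) = letter (base<k (toℕ<n j)) (tiles-tiled (suc n) t)
    lower-tiled (suc (suc n)) (inj₁ (inj₂ t))       = letter c<k (letter c<k (tiles-tiled n t))
    lower-tiled (suc (suc n)) (inj₂ (inj₁ (a , e))) = letter (toℕ<n a) (lower-tiled (suc n) e)
    lower-tiled (suc (suc n)) (inj₂ (inj₂ e))       = pair (lower-tiled n e)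

    upper-tiled : ∀ n e → Tiled (upper n e)
    upper-tiled (suc (suc n)) (inj₁ (inj₁ (j , t))) = letter (s≤s (toℕ<n j)) (tiles-tiled (suc n) t)
    upper-tiled (suc (suc n)) (inj₁ (inj₂ t))       = pair (tiles-tiled n t)
    upper-tiled (suc (suc n)) (inj₂ (inj₁ (a , e))) = letter (toℕ<n a) (upper-tiled (suc n) e)
    upper-tiled (suc (suc n)) (inj₂ (inj₂ e))       = pair (upper-tiled n e)

    lower-step : ∀ n e → Step (lower n e) (upper n e)
    lower-step (suc (suc n)) (inj₁ (inj₁ (j , t))) = single [] _ (toℕ<n j)
    lower-step (suc (suc n)) (inj₁ (inj₂ t))       = double [] _
    lower-step (suc (suc n)) (inj₂ (inj₁ (a , e))) = Step-∷ _ (lower-step (suc n) e)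
    lower-step (suc (suc n)) (inj₂ (inj₂ e))       = Step-∷ k (Step-∷ k (lower-step n e))

    -- This fixes the orientation of an edge: no edge can be a step in both directions.
    Step-sum : ∀ {x y} → Step x y → sum x < sum y
    Step-sum (single [] v {j} _)  = +-mono-<-≤ (s≤s (base-≤ j)) ≤-refl
    Step-sum (double [] v)        = +-mono-<-≤ c<k (+-mono-≤ (<⇒≤ c<k) ≤-refl)
    Step-sum (single (a ∷ u) v j<p) = +-monoʳ-< a (Step-sum (single u v j<p))
    Step-sum (double (a ∷ u) v)     = +-monoʳ-< a (Step-sum (double u v))

    kept-head : ∀ n e → head (lower (suc (suc n)) (inj₂ e)) ≡ head (upper (suc (suc n)) (inj₂ e))
    kept-head n (inj₁ _) = refl
    kept-head n (inj₂ _) = refl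

    changed-head : ∀ n e → head (lower (suc (suc n)) (inj₁ e)) ≢ head (upper (suc (suc n)) (inj₁ e))
    changed-head n (inj₁ (j , _)) = base≢suc (toℕ j) ∘ just-injective
    changed-head n (inj₂ _)       = <⇒≢ c<k ∘ just-injective

    -- The outer summand of a code can be read off its two ends: they differ in the first entry
    -- exactly when the first tile is the changed place.
    changed≢kept : ∀ n e f → lower (suc (suc n)) (inj₁ e) ≡ lower (suc (suc n)) (inj₂ f) →
                   upper (suc (suc n)) (inj₁ e) ≢ upper (suc (suc n)) (inj₂ f)
    changed≢kept n e f l u =
      changed-head n e (trans (cong head l) (trans (kept-head n f) (cong head (sym u))))

    code-injective : ∀ n e f → lower n e ≡ lower n f → upper n e ≡ upper n f → e ≡ f
    code-injective (suc (suc n)) (inj₁ e) (inj₂ f) l u =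
      contradiction u (changed≢kept n e f l)
    code-injective (suc (suc n)) (inj₂ e) (inj₁ f) l u =
      contradiction (sym u) (changed≢kept n f e (sym l))
    -- At the changed place the upper ends are compared, since `base` may be constant and forget
    -- `j`.
    code-injective (suc (suc n)) (inj₁ (inj₁ (i , s))) (inj₁ (inj₁ (j , t))) _ u =
      cong₂ (λ i r → inj₁ (inj₁ (i , r))) (toℕ-injective (suc-injective (∷-injectiveˡ u)))
                                          (tiles-injective (suc n) s t (∷-injectiveʳ u))
    code-injective (suc (suc n)) (inj₁ (inj₁ (i , _))) (inj₁ (inj₂ _)) _ u =
      contradiction (suc-injective (∷-injectiveˡ u)) (<⇒≢ (toℕ<n i))
    code-injective (suc (suc n)) (inj₁ (inj₂ _)) (inj₁ (inj₁ (j , _))) _ u =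
      contradiction (suc-injective (sym (∷-injectiveˡ u))) (<⇒≢ (toℕ<n j))
    code-injective (suc (suc n)) (inj₁ (inj₂ s)) (inj₁ (inj₂ t)) _ u =
      cong (inj₁ ∘ inj₂) (tiles-injective n s t (∷-injectiveʳ (∷-injectiveʳ u)))
    code-injective (suc (suc n)) (inj₂ (inj₁ (a , e))) (inj₂ (inj₁ (b , f))) l u =
      cong₂ (λ a r → inj₂ (inj₁ (a , r))) (toℕ-injective (∷-injectiveˡ l))
        (code-injective (suc n) e f (∷-injectiveʳ l) (∷-injectiveʳ u))
    code-injective (suc (suc n)) (inj₂ (inj₁ (a , _))) (inj₂ (inj₂ _)) l _ =
      contradiction (∷-injectiveˡ l) (<⇒≢ (toℕ<n a))
    code-injective (suc (suc n)) (inj₂ (inj₂ _)) (inj₂ (inj₁ (b , _))) l _ =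
      contradiction (sym (∷-injectiveˡ l)) (<⇒≢ (toℕ<n b))
    code-injective (suc (suc n)) (inj₂ (inj₂ e)) (inj₂ (inj₂ f)) l u =
      cong (inj₂ ∘ inj₂) (code-injective n e f (∷-injectiveʳ (∷-injectiveʳ l))
                                               (∷-injectiveʳ (∷-injectiveʳ u)))

    Coded : Rel (List ℕ) 0ℓ
    Coded x y = ∃[ e ] lower (suc (length x)) e ≡ x × upper (suc (length x)) e ≡ y

    Coded-letter : ∀ {a x y} → a < k → Coded x y → Coded (a ∷ x) (a ∷ y)
    Coded-letter a<k (e , l , u) =
      inj₂ (inj₁ (fromℕ< a<k , e)) , cong₂ _∷_ (toℕ-fromℕ< a<k) l , cong₂ _∷_ (toℕ-fromℕ< a<k) u

    Coded-pair : ∀ {x y} → Coded x y → Coded (k ∷ k ∷ x) (k ∷ k ∷ y)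
    Coded-pair (e , l , u) = inj₂ (inj₂ e) , cong (λ w → k ∷ k ∷ w) l , cong (λ w → k ∷ k ∷ w) u

    -- The letter to be changed is below `k`, so it is a tile of its own and the prefix `u` consists
    -- of whole tiles, which are kept one by one. The shape of `x` is a separate equation so that
    -- its tiling can be matched on.
    single-coded : ∀ {x} u v {j} → j < p → Tiled x → x ≡ u ++ base j ∷ v → Coded x (u ++ suc j ∷ v)
    single-coded [] v {j} j<p (letter _ t) refl with s , eq ← tiles-surjective t =
      inj₁ (inj₁ (fromℕ< j<p , s)) ,
      cong₂ _∷_ (cong base (toℕ-fromℕ< j<p)) eq ,
      cong₂ _∷_ (cong suc (toℕ-fromℕ< j<p)) eq
    single-coded [] v j<p (pair _) eq =
      contradiction (sym (∷-injectiveˡ eq)) (<⇒≢ (base<k j<p))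
    single-coded (_ ∷ u) v j<p (letter a<k t) refl = Coded-letter a<k (single-coded u v j<p t refl)
    -- The changed place would be the second half of a pair.
    single-coded (_ ∷ []) v j<p (pair _) eq =
      contradiction (sym (∷-injectiveˡ (∷-injectiveʳ eq))) (<⇒≢ (base<k j<p))
    single-coded (_ ∷ _ ∷ u) v j<p (pair t) refl = Coded-pair (single-coded u v j<p t refl)

    double-coded : ∀ {x} u v → Tiled x → x ≡ u ++ c ∷ c ∷ v → Coded x (u ++ k ∷ k ∷ v)
    double-coded [] v (letter _ (letter _ t)) refl with s , eq ← tiles-surjective t =
      inj₁ (inj₂ s) , cong (λ w → c ∷ c ∷ w) eq , cong (λ w → k ∷ k ∷ w) eq
    -- The second `c` would open a pair, although `c < k`.
    double-coded [] v (letter _ (pair _)) eq =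
      contradiction (sym (∷-injectiveˡ (∷-injectiveʳ eq))) (<⇒≢ c<k)
    double-coded [] v (pair _) eq = contradiction (sym (∷-injectiveˡ eq)) (<⇒≢ c<k)
    double-coded (_ ∷ u) v (letter a<k t) refl = Coded-letter a<k (double-coded u v t refl)
    double-coded (_ ∷ []) v (pair _) eq =
      contradiction (sym (∷-injectiveˡ (∷-injectiveʳ eq))) (<⇒≢ c<k)
    double-coded (_ ∷ _ ∷ u) v (pair t) refl = Coded-pair (double-coded u v t refl)

    code-surjective : ∀ {n x y} → length x ≡ n → Tiled x → Step x y →
                      ∃[ e ] lower (suc n) e ≡ x × upper (suc n) e ≡ y
    code-surjective refl t (single u v j<p) = single-coded u v j<p t refl
    code-surjective refl t (double u v)     = double-coded u v t refl

    hasEdgeCount : ∀ n {S : Rel (List ℕ) 0ℓ} (S⇒≢ : ∀ {x y} → S x y → x ≢ y) →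
                   (∀ {x y} → S x y → Step x y) → (∀ {x y} → Step x y → S x y) →
                   HasEdgeCount (stepGraph n k S S⇒≢) (edgeCount (suc n))
    hasEdgeCount n {S} S⇒≢ S⇒Step Step⇒S = record
      { to        = toEdge ∘ codes.to
      ; cong      = λ { refl → inj₁ (refl , refl) }
      ; bijective = (λ {i} {j} eq → Injection.injective (↔⇒↣ codes↔) (toEdge-injective (codes.to i) (codes.to j) eq))
                  , λ e → let f , eq = toEdge-surjective e in
                      -- Surjectivity is demanded for everything equal to the witness; matching
                      -- `refl` leaves the round trip `codes.to (codes.from f)`.
                      codes.from f , λ { refl →
                        subst (λ f → toEdge f ≈ᴱ e) (sym (codes.strictlyInverseˡ f)) eq }
      }
      where
      open SimpleGraph (stepGraph n k S S⇒≢) using (Edge; edge; _≈ᴱ_)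
      codes↔ = EdgeCode-count (suc n)
      module codes = Inverse codes↔

      toEdge : EdgeCode (suc n) → Edge
      toEdge e = edge
        {source = Tiled⇒PellString (suc-injective (lower-length (suc n) e)) (lower-tiled (suc n) e)}
        {target = Tiled⇒PellString (suc-injective (upper-length (suc n) e)) (upper-tiled (suc n) e)}
        (inj₁ (Step⇒S (lower-step (suc n) e)))

      toEdge-injective : ∀ e f → toEdge e ≈ᴱ toEdge f → e ≡ f
      toEdge-injective e f (inj₁ (l , u)) = code-injective (suc n) e f l u
      -- Were `f` the reversal of `e`, the entry sum would grow in both directions.
      toEdge-injective e f (inj₂ (l , u)) = contradiction
        (<-trans (Step-sum (lower-step (suc n) e))
                 (subst₂ _<_ (cong sum (sym u)) (cong sum (sym l)) (Step-sum (lower-step (suc n) f))))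
        (<-irrefl refl)

      tiled : ∀ (s : PellString n k) → Tiled (word s)
      tiled s = EvenRuns⇒Tiled (letters≤k s) (evenRuns s)

      toEdge-surjective : ∀ e → ∃[ f ] toEdge f ≈ᴱ e
      toEdge-surjective (edge {s} {t} (inj₁ st))
        with f , l , u ← code-surjective (length≡n s) (tiled s) (S⇒Step st) = f , inj₁ (l , u)
      -- The step runs from target to source, so the code found is that of the reversed edge.
      toEdge-surjective (edge {s} {t} (inj₂ st))
        with f , l , u ← code-surjective (length≡n t) (tiled t) (S⇒Step st) = f , inj₂ (l , u)

  -- The two graphs as instances.

  module Munarini = Lowering (const 0) (λ _ → z≤n) 0 (s≤s z≤n)
  module Generalized = Lowering id (λ _ → ≤-refl) p ≤-refl

  munarini-count : ∀ n → HasEdgeCount (munariniGraph n k) (edgeCount (suc n))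
  munarini-count n = Munarini.hasEdgeCount n MunariniStep⇒≢
    (λ { (single u v {suc _} _ (s≤s j<p)) → Munarini.single u v j<p
       ; (double u v)                     → Munarini.double u v })
    (λ { (Munarini.single u v j<p) → single u v (s≤s z≤n) (s≤s j<p)
       ; (Munarini.double u v)     → double u v })

  pell-count : ∀ n → HasEdgeCount (pellGraph n k) (edgeCount (suc n))
  pell-count n = Generalized.hasEdgeCount n PellStep⇒≢
    (λ { (single u v (s≤s j<p)) → Generalized.single u v j<p
       ; (double u v)           → Generalized.double u v })
    (λ { (Generalized.single u v j<p) → single u v (s≤s j<p)
       ; (Generalized.double u v)     → double u v })

  -- The recurrence and the closed form.

  -- The numerator, with `a` and `b` standing for the k-Fibonacci numbers of index `n` and `n + 1`.
  -- Integers are used because `K - + 2` is negative for `k = 1`.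
  closedForm : (K N a b : ℤ) → ℤ
  closedForm K N a b = (K ^ 2 - K + + 2) * N * b + (K - + 2) * (+ 1 + N) * a

  private
    closedForm′ : ∀ {m} (K N a b : Polynomial m) → Polynomial m
    -- The square is written the way `K ^ 2` unfolds, so that the solver's result matches
    -- `closedForm` by computation.
    closedForm′ K N a b = (K :* (K :* con (+ 1)) :- K :+ con (+ 2)) :* N :* b
                          :+ (K :- con (+ 2)) :* (con (+ 1) :+ N) :* a

  closedForm-0 : ∀ P → + 0 ≡ closedForm (+ 1 + P) (+ 0) (+ 0) (+ 1)
  closedForm-0 = solve 1 (λ P →
    con (+ 0) := closedForm′ (con (+ 1) :+ P) (con (+ 0)) (con (+ 0)) (con (+ 1))) refl

  closedForm-1 : ∀ P → let K = + 1 + P in P * (+ 4 + K ^ 2) ≡ closedForm K (+ 1) (+ 1) K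
  closedForm-1 = solve 1 (λ P → let K = con (+ 1) :+ P in
    P :* (con (+ 4) :+ K :* (K :* con (+ 1))) := closedForm′ K (con (+ 1)) (con (+ 1)) K) refl

  -- Once the next two k-Fibonacci numbers are expressed through `a` and `b`, the recurrence is a
  -- polynomial identity, valid for arbitrary `a` and `b`. The variable is `P`, standing for
  -- `k - 1`, so that `+ 1 + P` computes to `+ k`.
  closedForm-rec : ∀ P N a b → let K = + 1 + P in
    (P * (K * b + a) + b) * (+ 4 + K ^ 2)
      + (K * closedForm K (+ 1 + N) b (K * b + a) + closedForm K N a b)
    ≡ closedForm K (+ 2 + N) (K * b + a) (K * (K * b + a) + b)
  closedForm-rec = solve 4 (λ P N a b → let K = con (+ 1) :+ P in
    (P :* (K :* b :+ a) :+ b) :* (con (+ 4) :+ K :* (K :* con (+ 1)))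
      :+ (K :* closedForm′ K (con (+ 1) :+ N) b (K :* b :+ a) :+ closedForm′ K N a b)
    := closedForm′ K (con (+ 2) :+ N) (K :* b :+ a) (K :* (K :* b :+ a) :+ b)) refl

  pos-*+ : ∀ m n o → + (m ℕ.* n ℕ.+ o) ≡ + m * + n + + o
  pos-*+ m n o = cong (_+ + o) (ℤ.pos-* m n)

  -- Two-step induction with the denominator cleared, so that everything stays in the integers.
  edgeCount-closed : ∀ n → + edgeCount (suc n) * (+ 4 + (+ k) ^ 2)
                           ≡ closedForm (+ k) (+ n) (+ kFib n k) (+ kFib (suc n) k)
  edgeCount-closed zero = closedForm-0 (+ p)
  edgeCount-closed (suc zero) = begin
    + edgeCount 2 * D                        ≡⟨ cong (λ m → + m * D) edgeCount-2 ⟩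
    + p * D                                  ≡⟨ closedForm-1 (+ p) ⟩
    closedForm (+ k) (+ 1) (+ 1) (+ k)       ≡⟨ cong (closedForm (+ k) (+ 1) (+ 1) ∘ +_) kFib-2 ⟨
    closedForm (+ k) (+ 1) (+ 1) (+ kFib 2 k) ∎
    where
    open ≡-Reasoning
    D = + 4 + (+ k) ^ 2
    kFib-2 : kFib 2 k ≡ k
    kFib-2 = trans (+-identityʳ (k ℕ.* 1)) (*-identityʳ k)
    edgeCount-2 : edgeCount 2 ≡ p
    edgeCount-2 rewrite *-identityʳ p | *-zeroʳ p | +-identityʳ p = +-identityʳ p
  edgeCount-closed (suc (suc n)) = begin
    + edgeCount (3 ℕ.+ n) * D
      ≡⟨ cong₂ (λ s t → (s + t) * D) (pos-*+ p _ _)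
               (pos-*+ k (edgeCount (2 ℕ.+ n)) (edgeCount (suc n))) ⟩
    (+ p * + kFib (2 ℕ.+ n) k + b + (+ k * y + x)) * D
      ≡⟨ distribute (+ p * + kFib (2 ℕ.+ n) k + b) (+ k) y x D ⟩
    (+ p * + kFib (2 ℕ.+ n) k + b) * D + (+ k * (y * D) + x * D)
      ≡⟨ cong₂ (λ s t → (+ p * + kFib (2 ℕ.+ n) k + b) * D + (+ k * s + t))
               (edgeCount-closed (suc n)) (edgeCount-closed n) ⟩
    (+ p * + kFib (2 ℕ.+ n) k + b) * D
      + (+ k * closedForm (+ k) (+ suc n) b (+ kFib (2 ℕ.+ n) k) + closedForm (+ k) (+ n) a b)
      -- `closedForm-rec` knows only `a` and `b`, so the k-Fibonacci number of index `2 + n` is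
      -- expanded before it and folded back after it.
      ≡⟨ cong (λ f → (+ p * f + b) * D
                       + (+ k * closedForm (+ k) (+ suc n) b f + closedForm (+ k) (+ n) a b)) fib₂ ⟩
    (+ p * (+ k * b + a) + b) * D
      + (+ k * closedForm (+ k) (+ suc n) b (+ k * b + a) + closedForm (+ k) (+ n) a b)
      ≡⟨ closedForm-rec (+ p) (+ n) a b ⟩
    closedForm (+ k) (+ (2 ℕ.+ n)) (+ k * b + a) (+ k * (+ k * b + a) + b)
      ≡⟨ cong (λ f → closedForm (+ k) (+ (2 ℕ.+ n)) f (+ k * f + b)) fib₂ ⟨
    closedForm (+ k) (+ (2 ℕ.+ n)) (+ kFib (2 ℕ.+ n) k) (+ k * + kFib (2 ℕ.+ n) k + b)
      ≡⟨ cong (closedForm (+ k) (+ (2 ℕ.+ n)) (+ kFib (2 ℕ.+ n) k)) (pos-*+ k (kFib (2 ℕ.+ n) k) _) ⟨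
    closedForm (+ k) (+ (2 ℕ.+ n)) (+ kFib (2 ℕ.+ n) k) (+ kFib (3 ℕ.+ n) k) ∎
    where
    open ≡-Reasoning
    D = + 4 + (+ k) ^ 2
    a = + kFib n k
    b = + kFib (suc n) k
    x = + edgeCount (suc n)
    y = + edgeCount (2 ℕ.+ n)
    fib₂ : + kFib (2 ℕ.+ n) k ≡ + k * b + a
    fib₂ = pos-*+ k (kFib (suc n) k) (kFib n k)
    distribute : ∀ s K y x D → (s + (K * y + x)) * D ≡ s * D + (K * (y * D) + x * D)
    distribute = solve 5 (λ s K y x D →
      (s :+ (K :* y :+ x)) :* D := s :* D :+ (K :* (y :* D) :+ x :* D)) refl

  edgeCount-ratio : ∀ n → + edgeCount (suc n) / 1
                          ≡ closedForm (+ k) (+ n) (+ kFib n k) (+ kFib (suc n) k) / (4 ℕ.+ k ℕ.^ 2)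
  -- Equality of unnormalised fractions is cross multiplication. `mkℚᵘ` stores the denominator minus
  -- one, hence `0` and `3 + k ^ 2`.
  edgeCount-ratio n = fromℚᵘ-cong {mkℚᵘ (+ edgeCount (suc n)) 0} {mkℚᵘ R (3 ℕ.+ k ℕ.^ 2)} (*≡* (begin
    + edgeCount (suc n) * (+ 4 + + (k ℕ.^ 2)) ≡⟨ cong (λ s → + edgeCount (suc n) * (+ 4 + s)) square ⟩
    + edgeCount (suc n) * (+ 4 + (+ k) ^ 2)   ≡⟨ edgeCount-closed n ⟩
    R                                         ≡⟨ ℤ.*-identityʳ R ⟨
    R * + 1                                   ∎))
    where
    open ≡-Reasoning
    R = closedForm (+ k) (+ n) (+ kFib n k) (+ kFib (suc n) k)
    square : + (k ℕ.^ 2) ≡ (+ k) ^ 2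
    square = trans (ℤ.pos-* k (k ℕ.* 1)) (cong (+ k *_) (ℤ.pos-* k 1))

proposition2p8 : ∀ (n k : ℕ) .{{_ : NonZero n}} .{{_ : NonZero k}} →
    ∃[ m ] HasEdgeCount (munariniGraph n k) m
    × HasEdgeCount (pellGraph n k) m
    × (+ m / 1 ≡ (((+ k) ^ 2 - + k + + 2) * + n * + kFib (ℕ.suc n) k
    + (+ k - + 2) * + (ℕ.suc n) * + kFib n k)
    / (4 ℕ.+ k ℕ.^ 2))
proposition2p8 n (suc p) = edgeCount (suc n) , munarini-count n , pell-count n , edgeCount-ratio n
  where open Pell p
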